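{- Let $(R,v)$ be a discrete valuation domain and let $f=a_0+a_1x+\cdots+a_nx^n\in R[x]$ with $n\ge 2$ and $a_0a_n\neq 0$. Suppose there is an index $s\in\{0,1,\ldots,n-1\}$ such that: (a) $m_i(f)<m_s(f)$ for all $i\in\{0,1,\ldots,n-1\}$ with $i\neq s$; (b) the integer $d=\gcd\bigl(v(a_s)-v(a_n),\,n-s\bigr)$ satisfies $d=n(n-s)\bigl(m_s(f)-m_0(f)\bigr)$ if $s\neq 0$, and $d=1$ if $s=0$. Then either $f$ is irreducible in $R[x]$, or $f$ has a factor in $R[x]$ whose degree is zero or a multiple of $(n-s)/d$. Precisely: whenever $f=f_1f_2$ with $f_1,f_2\in R[x]$, the integer $(n-s)/d$ divides $\deg f_1$ or $\deg f_2$.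
   Context: $(R,v)$ is a discrete valuation domain with (discrete) valuation $v$, extended by $v(0)=+\infty$. For a polynomial $f=a_0+a_1x+\cdots+a_nx^n\in R[x]$ of degree $n$ (so $a_n\ne 0$) and $i\in\{0,\ldots,n-1\}$, define $m_i(f)=\dfrac{v(a_n)-v(a_i)}{n-i}$ (the slope of the segment joining $(i,v(a_i))$ and $(n,v(a_n))$; it equals $-\infty$ if $a_i=0$). -}

module Defs where

open import Level using (Level; _⊔_) renaming (suc to lsuc)
open import Algebra.Bundles using (CommutativeRing)
open import Algebra.Morphism.Structures using (IsRingMonomorphism)
open import Data.Bool.Base using (if_then_else_)
open import Data.Integer.Base as ℤ using (ℤ; +_; ∣_∣)
open import Data.List.Base using (List; []; _∷_; map)
open import Data.List.Relation.Unary.All using (all?)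
open import Data.Nat.Base as ℕ using (ℕ; zero; suc; _∸_; NonZero)
import Data.Nat.GCD as ℕ
import Data.Nat.Properties as ℕ
open import Data.Product.Base using (∃)
open import Data.Rational.Base as ℚ using (ℚ)
open import Data.Sum.Base using (inj₂)
open import Function.Bundles using (_⇔_; module Equivalence)
open import Relation.Binary.Construct.Add.Supremum.NonStrict ℤ._≤_ using (_≤⁺_)
open import Relation.Binary.PropositionalEquality.Core using (_≡_; refl; sym; trans)
open import Relation.Nullary.Construct.Add.Infimum using (_₋; ⊥₋)
open import Relation.Nullary.Construct.Add.Supremum using (_⁺; ⊤⁺; [_])
open import Relation.Nullary.Decidable.Core using (Dec; yes; no; does)
open import Relation.Nullary.Negation.Core using (¬_)

infixl 6 _+⁺_
infixl 7 _⊓⁺_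

_+⁺_ : ℤ ⁺ → ℤ ⁺ → ℤ ⁺
⊤⁺    +⁺ _     = ⊤⁺
[ _ ] +⁺ ⊤⁺    = ⊤⁺
[ i ] +⁺ [ j ] = [ i ℤ.+ j ]

_⊓⁺_ : ℤ ⁺ → ℤ ⁺ → ℤ ⁺
⊤⁺    ⊓⁺ y     = y
[ i ] ⊓⁺ ⊤⁺    = [ i ]
[ i ] ⊓⁺ [ j ] = [ i ℤ.⊓ j ]

-- The value at ⊤⁺ is a dummy: finite⁺ is meant only for valuations of
-- non-zero elements.
finite⁺ : ℤ ⁺ → ℤ
finite⁺ ⊤⁺    = ℤ.0ℤ
finite⁺ [ i ] = i

-- The value at ⊥₋ is a dummy: finite₋ is meant only for slopes mᵢ(f) with aᵢ ≉ 0.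
finite₋ : ℚ ₋ → ℚ
finite₋ ⊥₋    = ℚ.0ℚ
finite₋ [ q ] = q

record IsField {c ℓ} (K : CommutativeRing c ℓ) : Set (c ⊔ ℓ) where
  open CommutativeRing K
  field
    1≉0     : ¬ (1# ≈ 0#)
    inverse : ∀ x → ¬ (x ≈ 0#) → ∃ λ y → x * y ≈ 1#

record IsDiscreteValuation {c ℓ} (K : CommutativeRing c ℓ)
         (val : CommutativeRing.Carrier K → ℤ ⁺) : Set (c ⊔ ℓ) where
  open CommutativeRing K
  field
    val-cong       : ∀ {x y} → x ≈ y → val x ≡ val y
    val-⊤          : ∀ x → val x ≡ ⊤⁺ ⇔ x ≈ 0#
    val-*          : ∀ x y → val (x * y) ≡ val x +⁺ val y
    val-+          : ∀ x y → val x ⊓⁺ val y ≤⁺ val (x + y)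
    val-surjective : ∀ i → ∃ λ x → val x ≡ [ i ]

-- R is identified, through ι, with the valuation ring of a discrete valuation
-- on a field K. That K is the field of fractions of R is then automatic.
record DiscreteValuationDomain c ℓ k ℓk : Set (lsuc (c ⊔ ℓ ⊔ k ⊔ ℓk)) where
  field
    R : CommutativeRing c ℓ
    K : CommutativeRing k ℓk
  private
    module R = CommutativeRing R
    module K = CommutativeRing K
  field
    K-isField           : IsField K
    val                 : K.Carrier → ℤ ⁺
    isDiscreteValuation : IsDiscreteValuation K val
    ι                   : R.Carrier → K.Carrier
    ι-isMonomorphism    : IsRingMonomorphism R.rawRing K.rawRing ι
    valuationRing       : ∀ x → [ ℤ.0ℤ ] ≤⁺ val x ⇔ ∃ λ r → ι r K.≈ x

  open CommutativeRing R public using (Carrier; _≈_; _+_; _*_; 0#; 1#)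

  v : Carrier → ℤ ⁺
  v r = val (ι r)

  _≟0 : ∀ r → Dec (r ≈ 0#)
  r ≟0 = decide (v r) refl
    where
    open IsRingMonomorphism ι-isMonomorphism using (injective; 0#-homo)
    open IsDiscreteValuation isDiscreteValuation using (val-⊤; val-cong)
    decide : ∀ w → v r ≡ w → Dec (r ≈ 0#)
    decide ⊤⁺ eq =
      yes (injective (K.trans (Equivalence.to (val-⊤ (ι r)) eq) (K.sym 0#-homo)))
    decide [ i ] eq = no λ r≈0 → absurd (trans (sym eq)
      (Equivalence.from (val-⊤ (ι r))
        (K.trans (IsRingMonomorphism.⟦⟧-cong ι-isMonomorphism r≈0) 0#-homo)))
      where
      absurd : ¬ ([ i ] ≡ ⊤⁺)
      absurd ()

module Polynomial {c ℓ k ℓk} (D : DiscreteValuationDomain c ℓ k ℓk) where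
  open DiscreteValuationDomain D

  infix  4 _≈ₚ_
  infixl 6 _+ₚ_
  infixl 7 _*ₚ_

  -- Coefficient lists, constant term first; trailing zeros are allowed, so
  -- polynomials are compared by _≈ₚ_.
  R[x] : Set c
  R[x] = List Carrier

  coeff : R[x] → ℕ → Carrier
  coeff []      _       = 0#
  coeff (a ∷ _) zero    = a
  coeff (_ ∷ p) (suc i) = coeff p i

  _≈ₚ_ : R[x] → R[x] → Set ℓ
  p ≈ₚ q = ∀ i → coeff p i ≈ coeff q i

  _+ₚ_ : R[x] → R[x] → R[x]
  []      +ₚ q       = q
  p       +ₚ []      = p
  (a ∷ p) +ₚ (b ∷ q) = (a + b) ∷ (p +ₚ q)

  _*ₚ_ : R[x] → R[x] → R[x]
  []      *ₚ q = []
  (a ∷ p) *ₚ q = map (a *_) q +ₚ (0# ∷ p *ₚ q)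

  -- The zero polynomial gets degree 0.
  deg : R[x] → ℕ
  deg []      = 0
  deg (_ ∷ p) = if does (all? _≟0 p) then 0 else suc (deg p)

  lc : R[x] → Carrier
  lc f = coeff f (deg f)

  ∸-nonZero : ∀ {i n} → i ℕ.< n → NonZero (n ∸ i)
  ∸-nonZero i<n = ℕ.>-nonZero (ℕ.m<n⇒0<n∸m i<n)

  -- (v(aₙ) - v(aᵢ)) / (n - i) for n = deg f; i < n forces f ≉ 0, so v(aₙ) is
  -- finite.
  m : (f : R[x]) (i : ℕ) → .(i ℕ.< deg f) → ℚ ₋
  m f i i<n with v (coeff f i)
  ... | ⊤⁺    = ⊥₋
  ... | [ α ] =
    [ ℚ._/_ (finite⁺ (v (lc f)) ℤ.- α) (deg f ∸ i) {{∸-nonZero i<n}} ]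

  -- When m f i <₋ m f s for some i, coeff f s is non-zero.
  d : R[x] → ℕ → ℕ
  d f s = ℕ.gcd ∣ finite⁺ (v (coeff f s)) ℤ.- finite⁺ (v (lc f)) ∣ (deg f ∸ s)

  d-nonZero : ∀ f s → s ℕ.< deg f → NonZero (d f s)
  d-nonZero f s s<n = ℕ.≢-nonZero
    (ℕ.gcd[m,n]≢0 ∣ finite⁺ (v (coeff f s)) ℤ.- finite⁺ (v (lc f)) ∣ (deg f ∸ s)
      (inj₂ (ℕ.≢-nonZero⁻¹ (deg f ∸ s) {{∸-nonZero s<n}})))

{-# OPTIONS --safe #-}
-- Put N = n − s, A = v(aₛ) − v(aₙ) and weigh a monomial of degree i and value α
-- by ω i α = N α + A i. By (a), the leading term of f has least weight. If P and
-- Q are the first terms of least weight in f₁ and f₂, then f has a term of weight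
-- ω P + ω Q at deg P + deg Q (Gauss), so the leading terms of f₁ and f₂ have
-- least weight too. Hence the excesses ω 0 v(fⱼ(0)) − ω (deg fⱼ) v(lc fⱼ) are
-- non-negative; they are multiples of d = gcd(A, N), and their sum is the excess
-- of f, which (b) says is d, or 0 if s = 0. So one of them vanishes, i.e.
-- N x = A deg fⱼ for some x, and cancelling d gives N / d ∣ deg fⱼ.

module Submission where

open import Defs
open import Data.Integer.Base as ℤ using (ℤ; +_; ∣_∣)
import Data.Integer.Divisibility.Signed as ℤ
import Data.Integer.Properties as ℤ
import Data.Integer.Tactic.RingSolver as ℤ
open import Data.List.Base using ([]; _∷_; map)
open import Data.List.Relation.Unary.All using (All; []; _∷_; all?)
open import Data.Nat.Base as ℕ using (ℕ; zero; suc; _∸_; _≤_; _<_; _/_)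
import Data.Nat.DivMod as ℕ
import Data.Nat.Divisibility as ℕ
import Data.Nat.GCD as ℕ
import Data.Nat.Properties as ℕ
open import Data.Nat.Divisibility using (_∣_)
open import Data.Nat.Properties using (m<n⇒0<n)
open import Data.Product.Base using (∃; ∃₂; _×_; _,_; proj₁; proj₂)
open import Data.Rational.Base as ℚ using ()
import Data.Rational.Properties as ℚ
open import Data.Rational.Unnormalised.Base as ℚᵘ using (mkℚᵘ)
import Data.Rational.Unnormalised.Properties as ℚᵘ
open import Data.Sum.Base as Sum using (_⊎_; inj₁; inj₂)
open import Function.Bundles using (module Equivalence)
open import Algebra.Morphism.Structures using (IsRingMonomorphism)
open import Algebra.Bundles using (CommutativeRing)
open import Relation.Binary.Construct.Add.Infimum.Strict ℚ._<_ using (_<₋_; [<]-injective)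
open import Relation.Binary.Construct.Add.Supremum.NonStrict ℤ._≤_ using (_≤⁺_; [_]; _≤⊤⁺)
open import Relation.Binary.Definitions using (_Respects_; Tri; tri<; tri≈; tri>)
open import Relation.Binary.PropositionalEquality.Core
  using (_≡_; _≢_; refl; sym; trans; cong; cong₂; subst; subst₂)
open import Relation.Binary.PropositionalEquality.Properties using (module ≡-Reasoning)
open import Relation.Nullary.Construct.Add.Infimum using (⊥₋; [_])
open import Relation.Nullary.Construct.Add.Supremum using (_⁺; ⊤⁺; [_])
open import Relation.Nullary.Decidable.Core using (Dec; yes; no)
open import Relation.Nullary.Negation.Core using (¬_; contradiction)
open import Relation.Unary using (Pred)

-- Earliest term of least weight in a finite range.

firstMinimum : (u : ℕ → ℤ ⁺) (ω : ℕ → ℤ → ℤ) (k : ℕ) →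
  (∀ j → j < k → u j ≡ ⊤⁺) ⊎
  (∃₂ λ i α → i < k × u i ≡ [ α ] ×
    (∀ j β → j < k → u j ≡ [ β ] → ω i α ℤ.≤ ω j β × (j < i → ω i α ℤ.< ω j β)))
firstMinimum u ω zero    = inj₁ λ _ ()
firstMinimum u ω (suc k) with u k in uk | firstMinimum u ω k
... | ⊤⁺ | inj₁ none = inj₁ all⊤
  where
  all⊤ : ∀ j → j < suc k → u j ≡ ⊤⁺
  all⊤ j j<1+k with ℕ.m<1+n⇒m<n∨m≡n j<1+k
  ... | inj₁ j<k  = none j j<k
  ... | inj₂ refl = uk
... | ⊤⁺ | inj₂ (i , α , i<k , ui , min) = inj₂ (i , α , ℕ.m<n⇒m<1+n i<k , ui , min′)
  where
  min′ : ∀ j β → j < suc k → u j ≡ [ β ] → ω i α ℤ.≤ ω j β × (j < i → ω i α ℤ.< ω j β)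
  min′ j β j<1+k uj with ℕ.m<1+n⇒m<n∨m≡n j<1+k
  ... | inj₁ j<k  = min j β j<k uj
  ... | inj₂ refl with () ← trans (sym uk) uj
... | [ γ ] | inj₁ none = inj₂ (k , γ , ℕ.n<1+n k , uk , min′)
  where
  min′ : ∀ j β → j < suc k → u j ≡ [ β ] → ω k γ ℤ.≤ ω j β × (j < k → ω k γ ℤ.< ω j β)
  min′ j β j<1+k uj with ℕ.m<1+n⇒m<n∨m≡n j<1+k
  ... | inj₁ j<k with () ← trans (sym (none j j<k)) uj
  ... | inj₂ refl with refl ← trans (sym uk) uj =
    ℤ.≤-refl , λ k<k → contradiction k<k (ℕ.<-irrefl refl)
-- The later index wins only if its weight is strictly smaller, so ties keep the earlier one.
... | [ γ ] | inj₂ (i , α , i<k , ui , min) with ω k γ ℤ.<? ω i α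
...   | yes ωk<ωi = inj₂ (k , γ , ℕ.n<1+n k , uk , min′)
  where
  min′ : ∀ j β → j < suc k → u j ≡ [ β ] → ω k γ ℤ.≤ ω j β × (j < k → ω k γ ℤ.< ω j β)
  min′ j β j<1+k uj with ℕ.m<1+n⇒m<n∨m≡n j<1+k
  ... | inj₁ j<k  =
    let ωk<ωj = ℤ.<-≤-trans ωk<ωi (proj₁ (min j β j<k uj)) in ℤ.<⇒≤ ωk<ωj , λ _ → ωk<ωj
  ... | inj₂ refl with refl ← trans (sym uk) uj =
    ℤ.≤-refl , λ k<k → contradiction k<k (ℕ.<-irrefl refl)
...   | no ωk≮ωi = inj₂ (i , α , ℕ.m<n⇒m<1+n i<k , ui , min′)
  where
  min′ : ∀ j β → j < suc k → u j ≡ [ β ] → ω i α ℤ.≤ ω j β × (j < i → ω i α ℤ.< ω j β)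
  min′ j β j<1+k uj with ℕ.m<1+n⇒m<n∨m≡n j<1+k
  ... | inj₁ j<k  = min j β j<k uj
  ... | inj₂ refl with refl ← trans (sym uk) uj =
    ℤ.≮⇒≥ ωk≮ωi , λ k<i → contradiction (ℕ.<-trans i<k k<i) (ℕ.<-irrefl refl)

-- Inequalities of integers and fractions.

+-cancelˡ-≤ : ∀ z {x y} → z ℤ.+ x ℤ.≤ z ℤ.+ y → x ℤ.≤ y
+-cancelˡ-≤ z le = ℤ.≮⇒≥ λ y<x → ℤ.<⇒≱ (ℤ.+-monoʳ-< z y<x) le

+-cancelʳ-≤ : ∀ z {x y} → x ℤ.+ z ℤ.≤ y ℤ.+ z → x ℤ.≤ y
+-cancelʳ-≤ z le = ℤ.≮⇒≥ λ y<x → ℤ.<⇒≱ (ℤ.+-monoˡ-< z y<x) le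

-- Once the denominators are successors, both sides are `fromℚᵘ` of unnormalised fractions, whose
-- order is cross-multiplication by definition.
/-cancel-< : ∀ i m j n .{{_ : ℕ.NonZero m}} .{{_ : ℕ.NonZero n}} →
  i ℚ./ m ℚ.< j ℚ./ n → i ℤ.* + n ℤ.< j ℤ.* + m
/-cancel-< i (suc m) j (suc n) lt = ℚᵘ.drop-*<* (ℚᵘ.<-respʳ-≃ (ℚ.toℚᵘ-fromℚᵘ (mkℚᵘ j n))
  (ℚᵘ.<-respˡ-≃ (ℚ.toℚᵘ-fromℚᵘ (mkℚᵘ i m)) (ℚ.toℚᵘ-mono-< lt)))

-- Hypothesis (b) has this shape, its factor being the product of the denominators of the two
-- slopes.
clearDenominators : ∀ e i m j n .{{_ : ℕ.NonZero m}} .{{_ : ℕ.NonZero n}} →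
  e ℚ./ 1 ≡ (+ (n ℕ.* m) ℚ./ 1) ℚ.* (i ℚ./ m ℚ.- j ℚ./ n) →
  e ≡ i ℤ.* + n ℤ.- j ℤ.* + m
clearDenominators e i m@(suc m-1) j n@(suc n-1) eq =
  ℤ.*-cancelʳ-≡ e _ (+ (m ℕ.* n)) (begin
    e ℤ.* + (m ℕ.* n)                       ≡⟨ cong (λ k → e ℤ.* + k) (ℕ.*-identityˡ (m ℕ.* n)) ⟨
    e ℤ.* + (1 ℕ.* (m ℕ.* n))               ≡⟨ ℚᵘ.drop-*≡* eqᵘ ⟩
    (+ (n ℕ.* m) ℤ.* (i ℤ.* + n ℤ.+ ℤ.- j ℤ.* + m)) ℤ.* + 1
                                            ≡⟨ ℤ.*-identityʳ _ ⟩
    + (n ℕ.* m) ℤ.* (i ℤ.* + n ℤ.+ ℤ.- j ℤ.* + m)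
                                            ≡⟨ ℤ.*-comm (+ (n ℕ.* m)) _ ⟩
    (i ℤ.* + n ℤ.+ ℤ.- j ℤ.* + m) ℤ.* + (n ℕ.* m)
                                            ≡⟨ cong₂ (λ x k → (i ℤ.* + n ℤ.+ x) ℤ.* + k)
                                                 (sym (ℤ.neg-distribˡ-* j (+ m))) (ℕ.*-comm n m) ⟩
    (i ℤ.* + n ℤ.- j ℤ.* + m) ℤ.* + (m ℕ.* n) ∎)
  where
  open ≡-Reasoning
  e/1 = mkℚᵘ e 0
  i/m = mkℚᵘ i m-1
  j/n = mkℚᵘ j n-1
  nm/1 = mkℚᵘ (+ (n ℕ.* m)) 0
  -- Unnormalised fractions keep their denominators literally, so equality cross-multiplies without
  -- reduction to lowest terms.
  eqᵘ : e/1 ℚᵘ.≃ nm/1 ℚᵘ.* (i/m ℚᵘ.- j/n)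
  eqᵘ = ℚᵘ.≃-trans (ℚᵘ.≃-sym (ℚ.toℚᵘ-fromℚᵘ e/1)) (ℚᵘ.≃-trans (ℚ.toℚᵘ-cong eq)
    (ℚᵘ.≃-trans (ℚ.toℚᵘ-homo-* (ℚ.fromℚᵘ nm/1) _) (ℚᵘ.*-cong (ℚ.toℚᵘ-fromℚᵘ nm/1)
      (ℚᵘ.≃-trans (ℚ.toℚᵘ-homo-+ (ℚ.fromℚᵘ i/m) _) (ℚᵘ.+-cong (ℚ.toℚᵘ-fromℚᵘ i/m)
        (ℚᵘ.≃-trans (ℚ.toℚᵘ-homo‿- (ℚ.fromℚᵘ j/n)) (ℚᵘ.-‿cong (ℚ.toℚᵘ-fromℚᵘ j/n))))))))

-- A non-zero multiple of `d` uses up the whole bound `d` and leaves nothing for `n`.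
∣∧+≤⇒≡0 : ∀ d {m n} .{{_ : ℕ.NonZero d}} → d ∣ m → m ℕ.+ n ≤ d → m ≡ 0 ⊎ n ≡ 0
∣∧+≤⇒≡0 d {zero}          _   _     = inj₁ refl
∣∧+≤⇒≡0 d {m@(suc _)} {n} d∣m m+n≤d = inj₂ (ℕ.n≤0⇒n≡0 (ℕ.+-cancelˡ-≤ m n 0
  (ℕ.≤-trans m+n≤d (ℕ.≤-trans (ℕ.∣⇒≤ d∣m) (ℕ.≤-reflexive (sym (ℕ.+-identityʳ m)))))))

-- Weights of monomials, and the excess of the constant term over the leading term.

module Weight (A : ℤ) (N : ℕ) where

  ω : ℕ → ℤ → ℤ
  ω i α = + N ℤ.* α ℤ.+ A ℤ.* + i

  ω-+ : ∀ i j α β → ω (i ℕ.+ j) (α ℤ.+ β) ≡ ω i α ℤ.+ ω j β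
  ω-+ i j α β = trans (cong (λ k → + N ℤ.* (α ℤ.+ β) ℤ.+ A ℤ.* k) (ℤ.pos-+ i j))
    (regroup (+ N) A α β (+ i) (+ j))
    where
    regroup : ∀ n a x y z w →
      n ℤ.* (x ℤ.+ y) ℤ.+ a ℤ.* (z ℤ.+ w) ≡ n ℤ.* x ℤ.+ a ℤ.* z ℤ.+ (n ℤ.* y ℤ.+ a ℤ.* w)
    regroup = ℤ.solve-∀

  ω-monoʳ-≤ : ∀ i {α β} → α ℤ.≤ β → ω i α ℤ.≤ ω i β
  ω-monoʳ-≤ i α≤β = ℤ.+-monoˡ-≤ (A ℤ.* + i) (ℤ.*-monoˡ-≤-nonNeg (+ N) α≤β)

  ω-cancelʳ-< : ∀ i {α β} → ω i α ℤ.< ω i β → α ℤ.< β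
  ω-cancelʳ-< i lt = ℤ.≰⇒> λ β≤α → ℤ.<⇒≱ lt (ω-monoʳ-≤ i β≤α)

  excess : ℕ → ℤ → ℤ → ℤ
  excess n κ ν = ω 0 κ ℤ.- ω n ν

  -- In this form each summand is visibly a multiple of gcd(A, N), and vanishing means N (κ - ν) = A
  -- n.
  excess-expand : ∀ n κ ν → excess n κ ν ≡ + N ℤ.* (κ ℤ.- ν) ℤ.- A ℤ.* + n
  excess-expand n κ ν = expand (+ N) A (+ n) κ ν
    where
    expand : ∀ N A n κ ν → (N ℤ.* κ ℤ.+ A ℤ.* + 0) ℤ.- (N ℤ.* ν ℤ.+ A ℤ.* n) ≡
      N ℤ.* (κ ℤ.- ν) ℤ.- A ℤ.* n
    expand = ℤ.solve-∀

  excess-+ : ∀ n₁ n₂ κ₁ κ₂ ν₁ ν₂ →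
    excess n₁ κ₁ ν₁ ℤ.+ excess n₂ κ₂ ν₂ ≡ excess (n₁ ℕ.+ n₂) (κ₁ ℤ.+ κ₂) (ν₁ ℤ.+ ν₂)
  excess-+ n₁ n₂ κ₁ κ₂ ν₁ ν₂ = trans
    (swap (ω 0 κ₁) (ω n₁ ν₁) (ω 0 κ₂) (ω n₂ ν₂))
    (sym (cong₂ ℤ._-_ (ω-+ 0 0 κ₁ κ₂) (ω-+ n₁ n₂ ν₁ ν₂)))
    where
    swap : ∀ a b c d → (a ℤ.- b) ℤ.+ (c ℤ.- d) ≡ (a ℤ.+ c) ℤ.- (b ℤ.+ d)
    swap = ℤ.solve-∀

  module _ .{{_ : ℕ.NonZero (ℕ.gcd ∣ A ∣ N)}} where
    private
      g = ℕ.gcd ∣ A ∣ N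

    gcd∣excess : ∀ n κ ν → g ∣ ∣ excess n κ ν ∣
    gcd∣excess n κ ν = subst (λ e → g ∣ ∣ e ∣) (sym (excess-expand n κ ν)) (ℤ.∣⇒∣ᵤ (ℤ.∣m∣n⇒∣m-n
      (ℤ.∣m⇒∣m*n {+ g} {+ N} (κ ℤ.- ν) (ℤ.∣ᵤ⇒∣ (ℕ.gcd[m,n]∣n ∣ A ∣ N)))
      (ℤ.∣m⇒∣m*n {+ g} {A} (+ n) (ℤ.∣ᵤ⇒∣ (ℕ.gcd[m,n]∣m ∣ A ∣ N)))))

    -- From N (κ - ν) = A n, `N` divides n ∣A∣ as well as n N, hence n g; then `g` is cancelled.
    excess≡0⇒∣ : ∀ n κ ν → ∣ excess n κ ν ∣ ≡ 0 → N / g ∣ n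
    excess≡0⇒∣ n κ ν ex≡0 = ℕ.*-cancelʳ-∣ g (subst₂ _∣_
      (sym (ℕ.m/n*n≡m (ℕ.gcd[m,n]∣n ∣ A ∣ N))) (sym (ℕ.c*gcd[m,n]≡gcd[cm,cn] n ∣ A ∣ N))
      (ℕ.gcd-greatest N∣nA (ℕ.n∣m*n n)))
      where
      Nx≡An : + N ℤ.* (κ ℤ.- ν) ≡ A ℤ.* + n
      Nx≡An = ℤ.i-j≡0⇒i≡j _ _ (trans (sym (excess-expand n κ ν)) (ℤ.∣i∣≡0⇒i≡0 ex≡0))
      N∣nA : N ∣ n ℕ.* ∣ A ∣
      N∣nA = subst (N ∣_)
        (trans (sym (ℤ.abs-* (+ N) (κ ℤ.- ν)))
          (trans (cong ∣_∣ Nx≡An) (trans (ℤ.abs-* A (+ n)) (ℕ.*-comm ∣ A ∣ n))))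
        (ℕ.m∣m*n ∣ κ ℤ.- ν ∣)

    excess≤gcd⇒∣ : ∀ n₁ n₂ κ₁ κ₂ ν₁ ν₂ → ω n₁ ν₁ ℤ.≤ ω 0 κ₁ → ω n₂ ν₂ ℤ.≤ ω 0 κ₂ →
      excess (n₁ ℕ.+ n₂) (κ₁ ℤ.+ κ₂) (ν₁ ℤ.+ ν₂) ℤ.≤ + g → (N / g ∣ n₁) ⊎ (N / g ∣ n₂)
    excess≤gcd⇒∣ n₁ n₂ κ₁ κ₂ ν₁ ν₂ le₁ le₂ sum≤g =
      Sum.map (excess≡0⇒∣ n₁ κ₁ ν₁) (excess≡0⇒∣ n₂ κ₂ ν₂)
        -- Both excesses are non-negative, so passing to absolute values keeps their sum, which is
        -- at most `g`.
        (∣∧+≤⇒≡0 g (gcd∣excess n₁ κ₁ ν₁) (ℤ.drop‿+≤+ (subst (ℤ._≤ + g)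
          (trans (sym (excess-+ n₁ n₂ κ₁ κ₂ ν₁ ν₂)) (sym (cong₂ ℤ._+_
            (ℤ.0≤i⇒+∣i∣≡i (ℤ.i≤j⇒0≤j-i le₁)) (ℤ.0≤i⇒+∣i∣≡i (ℤ.i≤j⇒0≤j-i le₂)))))
          sum≤g)))

-- The segment joining (s, σ) and (n, ν).

module Edge {s n : ℕ} (s<n : s < n) (σ ν : ℤ) where
  open Weight (σ ℤ.- ν) (n ∸ s)

  pos-∸ : ∀ {i} → i < n → + (n ∸ i) ≡ + n ℤ.- + i
  pos-∸ {i} i<n = sym (trans (ℤ.m-n≡m⊖n n i) (ℤ.⊖-≥ (ℕ.<⇒≤ i<n)))

  -- The segment falls by A = σ - ν over a run of N = n - s, and ω is constant along lines of slope
  -- -A / N.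
  ω-edge : ω n ν ≡ ω s σ
  ω-edge = subst (λ k → k ℤ.* ν ℤ.+ (σ ℤ.- ν) ℤ.* + n ≡ k ℤ.* σ ℤ.+ (σ ℤ.- ν) ℤ.* + s)
    (sym (pos-∸ s<n)) (eq (+ n) (+ s) σ ν)
    where
    eq : ∀ n s σ ν → (n ℤ.- s) ℤ.* ν ℤ.+ (σ ℤ.- ν) ℤ.* n ≡
      (n ℤ.- s) ℤ.* σ ℤ.+ (σ ℤ.- ν) ℤ.* s
    eq = ℤ.solve-∀

  slope<⇒ω≤ : ∀ {i α} → i < n →
    (ν ℤ.- α) ℤ.* + (n ∸ s) ℤ.< (ν ℤ.- σ) ℤ.* + (n ∸ i) → ω n ν ℤ.≤ ω i α
  slope<⇒ω≤ {i} {α} i<n lt = ℤ.<⇒≤ (subst₂ ℤ._<_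
    (eqˡ (+ (n ∸ s)) (+ n) α σ ν)
    (trans (cong (λ k → (ν ℤ.- σ) ℤ.* k ℤ.+ z) (pos-∸ i<n)) (eqʳ (+ (n ∸ s)) (+ n) (+ i) α σ ν))
    (ℤ.+-monoˡ-< z lt))
    where
    -- Adding this to both sides turns the cross-multiplied slopes into the weights at `n` and at
    -- `i`.
    z = ω n α
    eqˡ : ∀ N n α σ ν → (ν ℤ.- α) ℤ.* N ℤ.+ (N ℤ.* α ℤ.+ (σ ℤ.- ν) ℤ.* n) ≡
      N ℤ.* ν ℤ.+ (σ ℤ.- ν) ℤ.* n
    eqˡ = ℤ.solve-∀
    eqʳ : ∀ N n i α σ ν → (ν ℤ.- σ) ℤ.* (n ℤ.- i) ℤ.+ (N ℤ.* α ℤ.+ (σ ℤ.- ν) ℤ.* n) ≡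
      N ℤ.* α ℤ.+ (σ ℤ.- ν) ℤ.* i
    eqʳ = ℤ.solve-∀

  -- For s = 0 the constant term is the left end of the segment, whose two ends weigh the same.
  excess-edge : s ≡ 0 → excess n σ ν ≡ ℤ.0ℤ
  excess-edge refl = ℤ.i≡j⇒i-j≡0 (sym ω-edge)

  -- The left side is n (n - s) (mₛ - m₀) with denominators cleared, `κ` being the value of the
  -- constant term.
  excess-gap : ∀ κ → (ν ℤ.- σ) ℤ.* + n ℤ.- (ν ℤ.- κ) ℤ.* + (n ∸ s) ≡ excess n κ ν
  excess-gap κ = trans (eq (+ (n ∸ s)) (+ n) κ σ ν) (sym (excess-expand n κ ν))
    where
    eq : ∀ N n κ σ ν → (ν ℤ.- σ) ℤ.* n ℤ.- (ν ℤ.- κ) ℤ.* N ≡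
      N ℤ.* (κ ℤ.- ν) ℤ.- (σ ℤ.- ν) ℤ.* n
    eq = ℤ.solve-∀

module PolynomialProperties {c ℓ κ ℓκ} (D : DiscreteValuationDomain c ℓ κ ℓκ) where
  open DiscreteValuationDomain D
  open Polynomial D
  private
    module R = CommutativeRing R
    module K = CommutativeRing K
  open IsDiscreteValuation isDiscreteValuation
  open IsRingMonomorphism ι-isMonomorphism using (⟦⟧-cong; injective; +-homo; *-homo; 0#-homo)
  open import Algebra.Properties.Ring R.ring using (-1*x≈-x)
  open import Relation.Binary.Reasoning.Setoid R.setoid

  -- Vanishing coefficients, degree and leading coefficient.

  coeff-zero : ∀ {p} → All (_≈ 0#) p → ∀ i → coeff p i ≈ 0#
  coeff-zero []         i       = R.refl
  coeff-zero (a≈0 ∷ _)  zero    = a≈0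
  coeff-zero (_ ∷ p≈0)  (suc i) = coeff-zero p≈0 i

  coeff-zero⁻¹ : ∀ p → (∀ i → coeff p i ≈ 0#) → All (_≈ 0#) p
  coeff-zero⁻¹ []      _   = []
  coeff-zero⁻¹ (a ∷ p) p≈0 = p≈0 0 ∷ coeff-zero⁻¹ p (λ i → p≈0 (suc i))

  deg<⇒coeff≈0 : ∀ p {i} → deg p < i → coeff p i ≈ 0#
  deg<⇒coeff≈0 []      _ = R.refl
  deg<⇒coeff≈0 (a ∷ p) {suc i} deg<i with all? _≟0 p
  ... | yes p≈0 = coeff-zero p≈0 i
  ... | no  _   = deg<⇒coeff≈0 p (ℕ.s<s⁻¹ deg<i)

  lc≈0⇒coeff≈0 : ∀ p → lc p ≈ 0# → ∀ i → coeff p i ≈ 0#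
  lc≈0⇒coeff≈0 []      _ _ = R.refl
  lc≈0⇒coeff≈0 (a ∷ p) lc≈0 i with all? _≟0 p
  lc≈0⇒coeff≈0 (a ∷ p) a≈0  zero    | yes _   = a≈0
  lc≈0⇒coeff≈0 (a ∷ p) _    (suc i) | yes p≈0 = coeff-zero p≈0 i
  lc≈0⇒coeff≈0 (a ∷ p) lc≈0 i       | no  p≉0 =
    contradiction (coeff-zero⁻¹ p (lc≈0⇒coeff≈0 p lc≈0)) p≉0

  -- Coefficients of sums and products.

  coeff-+ : ∀ p q i → coeff (p +ₚ q) i ≈ coeff p i + coeff q i
  coeff-+ []      q       i       = R.sym (R.+-identityˡ _)
  coeff-+ (a ∷ p) []      i       = R.sym (R.+-identityʳ _)
  coeff-+ (a ∷ p) (b ∷ q) zero    = R.refl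
  coeff-+ (a ∷ p) (b ∷ q) (suc i) = coeff-+ p q i

  coeff-scale : ∀ a q i → coeff (map (a *_) q) i ≈ a * coeff q i
  coeff-scale a []      i       = R.sym (R.zeroʳ a)
  coeff-scale a (b ∷ q) zero    = R.refl
  coeff-scale a (b ∷ q) (suc i) = coeff-scale a q i

  coeff-∷* : ∀ a p q i →
    coeff ((a ∷ p) *ₚ q) i ≈ a * coeff q i + coeff (0# ∷ p *ₚ q) i
  coeff-∷* a p q i =
    R.trans (coeff-+ (map (a *_) q) (0# ∷ p *ₚ q) i) (R.+-congʳ (coeff-scale a q i))

  -- Taken with `P` the class of zero, this yields the degree of a product; with `P` some `𝔪^ c`,
  -- the Gauss step.
  module Additive {ℓ′} {P : Pred Carrier ℓ′} (resp : P Respects _≈_) (0∈ : P 0#)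
                  (+∈ : ∀ {x y} → P x → P y → P (x + y)) where

    coeff-*∈ : ∀ p q k → (∀ i j → i ℕ.+ j ≡ k → P (coeff p i * coeff q j)) →
      P (coeff (p *ₚ q) k)
    coeff-*∈ []      q k h = 0∈
    coeff-*∈ (a ∷ p) q k h = resp (R.sym (coeff-∷* a p q k)) (+∈ (h 0 k refl) (tail k h))
      where
      tail : ∀ k → (∀ i j → i ℕ.+ j ≡ k → P (coeff (a ∷ p) i * coeff q j)) →
        P (coeff (0# ∷ p *ₚ q) k)
      tail zero    h = 0∈
      tail (suc k) h = coeff-*∈ p q k λ i j i+j≡k → h (suc i) j (cong suc i+j≡k)

    -- The remainder `r` collects all products of index sum `i + j` other than the chosen one.
    coeff-*-dominant : ∀ p q i j →
      (∀ i′ j′ → i′ ℕ.+ j′ ≡ i ℕ.+ j → i′ ≢ i → P (coeff p i′ * coeff q j′)) →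
      ∃ λ r → P r × coeff (p *ₚ q) (i ℕ.+ j) ≈ coeff p i * coeff q j + r
    coeff-*-dominant [] q i j h = 0# , 0∈ , (begin
      0#                    ≈⟨ R.zeroˡ _ ⟨
      0# * coeff q j        ≈⟨ R.+-identityʳ _ ⟨
      0# * coeff q j + 0#   ∎)
    coeff-*-dominant (a ∷ p) q zero zero h = 0# , 0∈ , coeff-∷* a p q 0
    coeff-*-dominant (a ∷ p) q zero (suc j) h =
      coeff (p *ₚ q) j
      , coeff-*∈ p q j (λ i′ j′ eq → h (suc i′) j′ (cong suc eq) λ ())
      , coeff-∷* a p q (suc j)
    coeff-*-dominant (a ∷ p) q (suc i) j h
      with r , r∈ , eq ← coeff-*-dominant p q i j
             (λ i′ j′ eq i′≢i → h (suc i′) j′ (cong suc eq) (λ e → i′≢i (ℕ.suc-injective e))) =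
      a * coeff q k + r , +∈ (h 0 k refl λ ()) r∈ , (begin
        coeff ((a ∷ p) *ₚ q) k              ≈⟨ coeff-∷* a p q k ⟩
        a * coeff q k + coeff (p *ₚ q) (i ℕ.+ j) ≈⟨ R.+-congˡ eq ⟩
        a * coeff q k + (x + r)             ≈⟨ R.+-assoc _ _ _ ⟨
        (a * coeff q k + x) + r             ≈⟨ R.+-congʳ (R.+-comm _ _) ⟩
        (x + a * coeff q k) + r             ≈⟨ R.+-assoc _ _ _ ⟩
        x + (a * coeff q k + r)             ∎)
      where
      k = suc (i ℕ.+ j)
      x = coeff p i * coeff q j

  module Zero = Additive {P = _≈ 0#} (λ x≈y x≈0 → R.trans (R.sym x≈y) x≈0) R.refl
    (λ x≈0 y≈0 → R.trans (R.+-cong x≈0 y≈0) (R.+-identityˡ 0#))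

  coeff-*-only : ∀ p q i j →
    (∀ i′ j′ → i′ ℕ.+ j′ ≡ i ℕ.+ j → i′ ≢ i → coeff p i′ * coeff q j′ ≈ 0#) →
    coeff (p *ₚ q) (i ℕ.+ j) ≈ coeff p i * coeff q j
  coeff-*-only p q i j h with r , r≈0 , eq ← Zero.coeff-*-dominant p q i j h =
    R.trans eq (R.trans (R.+-congˡ r≈0) (R.+-identityʳ _))

  coeff-*-0 : ∀ p q → coeff (p *ₚ q) 0 ≈ coeff p 0 * coeff q 0
  coeff-*-0 p q = coeff-*-only p q 0 0 λ { zero _ _ 0≢0 → contradiction refl 0≢0 }

  deg<⇒product≈0 : ∀ p q i j → deg p < i ⊎ deg q < j → coeff p i * coeff q j ≈ 0#
  deg<⇒product≈0 p q i j (inj₁ lt) = R.trans (R.*-congʳ (deg<⇒coeff≈0 p lt)) (R.zeroˡ _)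
  deg<⇒product≈0 p q i j (inj₂ lt) = R.trans (R.*-congˡ (deg<⇒coeff≈0 q lt)) (R.zeroʳ _)

  coeff-*-deg : ∀ p q → coeff (p *ₚ q) (deg p ℕ.+ deg q) ≈ lc p * lc q
  coeff-*-deg p q = coeff-*-only p q (deg p) (deg q) λ i j i+j≡ i≢ →
    deg<⇒product≈0 p q i j (beyond i j i+j≡ i≢)
    where
    beyond : ∀ i j → i ℕ.+ j ≡ deg p ℕ.+ deg q → i ≢ deg p → deg p < i ⊎ deg q < j
    beyond i j i+j≡ i≢ with ℕ.<-cmp i (deg p)
    ... | tri< i<  _ _ = inj₂ (ℕ.+-cancelˡ-< (deg p) _ _
                           (subst (_< deg p ℕ.+ j) i+j≡ (ℕ.+-monoˡ-< j i<)))
    ... | tri≈ _ i≡ _  = contradiction i≡ i≢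
    ... | tri> _ _ >i  = inj₁ >i

  coeff-*-beyond : ∀ p q {k} → deg p ℕ.+ deg q < k → coeff (p *ₚ q) k ≈ 0#
  coeff-*-beyond p q {k} lt = Zero.coeff-*∈ p q k λ i j i+j≡k →
    deg<⇒product≈0 p q i j (beyond i j i+j≡k)
    where
    beyond : ∀ i j → i ℕ.+ j ≡ k → deg p < i ⊎ deg q < j
    beyond i j i+j≡k with deg p ℕ.<? i
    ... | yes <i = inj₁ <i
    ... | no  ≮i = inj₂ (ℕ.+-cancelˡ-< (deg p) _ _ (ℕ.<-≤-trans
                     (subst (_ <_) (sym i+j≡k) lt) (ℕ.+-monoˡ-≤ j (ℕ.≮⇒≥ ≮i))))

  -- The coefficient at `deg p + deg q` is `lc p * lc q` and all later ones vanish, which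
  -- contradicts a strict inequality of degrees either way.
  deg-* : ∀ f p q → f ≈ₚ p *ₚ q → ¬ (lc f ≈ 0#) → ¬ (lc p * lc q ≈ 0#) →
    deg f ≡ deg p ℕ.+ deg q
  deg-* f p q f≈pq lcf≉0 lcp*lcq≉0 = ℕ.≤-antisym
    (ℕ.≮⇒≥ λ lt → lcf≉0 (R.trans (f≈pq _) (coeff-*-beyond p q lt)))
    (ℕ.≮⇒≥ λ lt → lcp*lcq≉0 (R.trans (R.sym (coeff-*-deg p q))
      (R.trans (R.sym (f≈pq _)) (deg<⇒coeff≈0 f lt))))

  -- The valuation on R and the powers of its maximal ideal.

  v-cong : ∀ {x y} → x ≈ y → v x ≡ v y
  v-cong x≈y = val-cong (⟦⟧-cong x≈y)

  v-* : ∀ x y → v (x * y) ≡ v x +⁺ v y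
  v-* x y = trans (val-cong (*-homo x y)) (val-* (ι x) (ι y))

  v-0 : v 0# ≡ ⊤⁺
  v-0 = Equivalence.from (val-⊤ (ι 0#)) 0#-homo

  v≡⊤⇒≈0 : ∀ {x} → v x ≡ ⊤⁺ → x ≈ 0#
  v≡⊤⇒≈0 eq = injective (K.trans (Equivalence.to (val-⊤ _) eq) (K.sym 0#-homo))

  ≉0⇒v-finite : ∀ {x} → ¬ (x ≈ 0#) → v x ≡ [ finite⁺ (v x) ]
  ≉0⇒v-finite {x} x≉0 with v x in eq
  ... | ⊤⁺    = contradiction (v≡⊤⇒≈0 eq) x≉0
  ... | [ _ ] = refl

  v-*-finite : ∀ {x y α β} → v x ≡ [ α ] → v y ≡ [ β ] → v (x * y) ≡ [ α ℤ.+ β ]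
  v-*-finite {x} {y} vx vy = trans (v-* x y) (cong₂ _+⁺_ vx vy)

  v-finite⇒≉0 : ∀ {x α} → v x ≡ [ α ] → ¬ (x ≈ 0#)
  v-finite⇒≉0 vx x≈0 = contradiction (trans (sym vx) (trans (v-cong x≈0) v-0)) λ ()

  -- The c-th power of the maximal ideal if c ≥ 0, all of R otherwise; as ℤ is
  -- discrete, v x > c is expressed as 𝔪^ (ℤ.suc c) x.
  𝔪^ : ℤ → Pred Carrier _
  𝔪^ c x = [ c ] ≤⁺ v x

  𝔪^-resp : ∀ {c} → (𝔪^ c) Respects _≈_
  𝔪^-resp {c} x≈y = subst ([ c ] ≤⁺_) (v-cong x≈y)

  𝔪^-0 : ∀ {c} → 𝔪^ c 0#
  𝔪^-0 {c} = subst ([ c ] ≤⁺_) (sym v-0) ([ c ] ≤⊤⁺)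

  𝔪^-+ : ∀ {c x y} → 𝔪^ c x → 𝔪^ c y → 𝔪^ c (x + y)
  𝔪^-+ {c} {x} {y} cx cy = subst ([ c ] ≤⁺_) (sym (val-cong (+-homo x y)))
      (≤⁺-trans ℤ.≤-trans (⊓-glb cx cy) (val-+ (ι x) (ι y)))
    where
    open import Relation.Binary.Construct.Add.Supremum.NonStrict ℤ._≤_ using (≤⁺-trans)
    ⊓-glb : ∀ {a b} → [ c ] ≤⁺ a → [ c ] ≤⁺ b → [ c ] ≤⁺ (a ⊓⁺ b)
    ⊓-glb {⊤⁺}            _   c≤b = c≤b
    ⊓-glb {[ _ ]} {⊤⁺}    c≤a _   = c≤a
    ⊓-glb {[ _ ]} {[ _ ]} [ c≤a ] [ c≤b ] = [ ℤ.⊓-glb c≤a c≤b ]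

  𝔪^-scale : ∀ {c} r {x} → 𝔪^ c x → 𝔪^ c (r * x)
  𝔪^-scale {c} r {x} cx = subst ([ c ] ≤⁺_) (sym (v-* r x))
      -- `valuationRing` gives the image of `r` a non-negative value, so multiplying by `r` keeps
      -- the bound.
      (shift (Equivalence.from (valuationRing (ι r)) (r , K.refl)) cx)
    where
    shift : ∀ {a b} → [ ℤ.0ℤ ] ≤⁺ a → [ c ] ≤⁺ b → [ c ] ≤⁺ (a +⁺ b)
    shift {⊤⁺}            _       _       = [ c ] ≤⊤⁺
    shift {[ _ ]} {⊤⁺}    _       _       = [ c ] ≤⊤⁺
    shift {[ _ ]} {[ _ ]} [ 0≤a ] [ c≤b ] =
      [ subst (ℤ._≤ _) (ℤ.+-identityˡ c) (ℤ.+-mono-≤ 0≤a c≤b) ]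

  -- Recovers x as (x + y) + (-1) y, closure under multiples serving to negate `y`.
  𝔪^-cancelʳ : ∀ {c x y} → 𝔪^ c y → 𝔪^ c (x + y) → 𝔪^ c x
  𝔪^-cancelʳ {x = x} {y} cy cxy = 𝔪^-resp (begin
    (x + y) + R.- 1# * y  ≈⟨ R.+-congˡ (-1*x≈-x y) ⟩
    (x + y) + R.- y       ≈⟨ R.+-assoc _ _ _ ⟩
    x + (y + R.- y)       ≈⟨ R.+-congˡ (R.-‿inverseʳ y) ⟩
    x + 0#                ≈⟨ R.+-identityʳ x ⟩
    x                     ∎) (𝔪^-+ cxy (𝔪^-scale (R.- 1#) cy))

  ∉𝔪^suc : ∀ {x α} → v x ≡ [ α ] → ¬ 𝔪^ (ℤ.suc α) x
  ∉𝔪^suc eq α<vx with [ α<α ] ← subst (_ ≤⁺_) eq α<vx = ℤ.<-irrefl refl (ℤ.suc[i]≤j⇒i<j α<α)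

  -- Gauss's lemma for weights.

  module Newton (A : ℤ) (N : ℕ) where
    open Weight A N

    -- Zero coefficients count as infinitely heavy, so only finite values are bounded.
    Minorant : ℤ → R[x] → Set
    Minorant w p = ∀ i α → v (coeff p i) ≡ [ α ] → w ℤ.≤ ω i α

    -- For positive `N`, the left end of the face of the Newton polygon on which ω is least.
    -- Strictness to its left is what makes the product of two corners dominate.
    record Corner (p : R[x]) : Set where
      field
        index   : ℕ
        value   : ℤ
        v-index : v (coeff p index) ≡ [ value ]
        minimal : Minorant (ω index value) p
        first   : ∀ i α → v (coeff p i) ≡ [ α ] → i < index → ω index value ℤ.< ω i α

    corner : ∀ p → ¬ (lc p ≈ 0#) → Corner p
    -- The range `suc (deg p)` includes the leading index; coefficients beyond it are zero and have
    -- no finite value.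
    corner p lc≉0 with firstMinimum (λ i → v (coeff p i)) ω (suc (deg p))
    ... | inj₁ none = contradiction (v≡⊤⇒≈0 (none (deg p) (ℕ.n<1+n (deg p)))) lc≉0
    ... | inj₂ (i , α , _ , vi , min) = record
      { index   = i
      ; value   = α
      ; v-index = vi
      ; minimal = λ j β vj → proj₁ (min j β (within j β vj) vj)
      ; first   = λ j β vj → proj₂ (min j β (within j β vj) vj)
      }
      where
      within : ∀ j β → v (coeff p j) ≡ [ β ] → j < suc (deg p)
      within j β vj = ℕ.≰⇒> λ deg<j →
        contradiction (trans (sym vj) (trans (v-cong (deg<⇒coeff≈0 p deg<j)) v-0)) λ ()

    open Corner

    -- If `i` precedes the corner of `p`, strictness comes from `first P`; otherwise `j` precedes
    -- the corner of `q` and it comes from `first Q`. As the index sum is that of the corners, a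
    -- larger weight means a larger value.
    corner-dominant : ∀ {p q} (P : Corner p) (Q : Corner q) i j →
      i ℕ.+ j ≡ index P ℕ.+ index Q → i ≢ index P →
      𝔪^ (ℤ.suc (value P ℤ.+ value Q)) (coeff p i * coeff q j)
    corner-dominant {p} {q} P Q i j i+j≡ i≢ =
      subst (_ ≤⁺_) (sym (v-* (coeff p i) (coeff q j))) (bound refl refl)
      where
      strict : ∀ {α β} → v (coeff p i) ≡ [ α ] → v (coeff q j) ≡ [ β ] →
        ω (index P) (value P) ℤ.+ ω (index Q) (value Q) ℤ.< ω i α ℤ.+ ω j β
      strict vi vj with ℕ.<-cmp i (index P)
      ... | tri< i<  _ _ = ℤ.+-mono-<-≤ (first P i _ vi i<) (minimal Q j _ vj)
      ... | tri≈ _ i≡ _  = contradiction i≡ i≢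
      ... | tri> _ _ >i  = ℤ.+-mono-≤-< (minimal P i _ vi) (first Q j _ vj
              (ℕ.+-cancelˡ-< (index P) _ _ (subst (index P ℕ.+ j <_) i+j≡ (ℕ.+-monoˡ-< j >i))))
      bound : ∀ {a b} → v (coeff p i) ≡ a → v (coeff q j) ≡ b →
        [ ℤ.suc (value P ℤ.+ value Q) ] ≤⁺ (a +⁺ b)
      bound {⊤⁺}            _  _  = _ ≤⊤⁺
      bound {[ _ ]} {⊤⁺}    _  _  = _ ≤⊤⁺
      bound {[ α ]} {[ β ]} vi vj = [ ℤ.i<j⇒suc[i]≤j (ω-cancelʳ-< (i ℕ.+ j) (subst₂ ℤ._<_
        (trans (sym (ω-+ (index P) (index Q) (value P) (value Q)))
          (cong (λ k → ω k (value P ℤ.+ value Q)) (sym i+j≡)))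
        (sym (ω-+ i j α β)) (strict vi vj))) ]

    -- Were the value of the coefficient at `k` above `e`, subtracting the dominated remainder would
    -- put the corner product above `e` too, yet its value is exactly `e`. So this term weighs at
    -- most the two corners together.
    minorant-* : ∀ {w p q} → Minorant w (p *ₚ q) → (P : Corner p) (Q : Corner q) →
      w ℤ.≤ ω (index P) (value P) ℤ.+ ω (index Q) (value Q)
    minorant-* {w} {p} {q} w≤ P Q = bound refl
      where
      k = index P ℕ.+ index Q
      e = value P ℤ.+ value Q
      ∉ : ¬ 𝔪^ (ℤ.suc e) (coeff (p *ₚ q) k)
      ∉ ∈ with r , r∈ , eq ← Additive.coeff-*-dominant {P = 𝔪^ (ℤ.suc e)} 𝔪^-resp 𝔪^-0 𝔪^-+
                p q (index P) (index Q) (corner-dominant P Q) =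
        ∉𝔪^suc (v-*-finite (v-index P) (v-index Q)) (𝔪^-cancelʳ r∈ (𝔪^-resp eq ∈))
      bound : ∀ {a} → v (coeff (p *ₚ q) k) ≡ a →
        w ℤ.≤ ω (index P) (value P) ℤ.+ ω (index Q) (value Q)
      bound {⊤⁺}    vk = contradiction (subst ([ ℤ.suc e ] ≤⁺_) (sym vk) (_ ≤⊤⁺)) ∉
      bound {[ γ ]} vk = subst (w ℤ.≤_) (ω-+ (index P) (index Q) (value P) (value Q))
        (ℤ.≤-trans (w≤ k γ vk) (ω-monoʳ-≤ k (ℤ.≮⇒≥ λ e<γ →
          ∉ (subst ([ ℤ.suc e ] ≤⁺_) (sym vk) [ ℤ.i<j⇒suc[i]≤j e<γ ]))))

    -- Each corner weighs at most the leading term of its factor, while by `minorant-*` the two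
    -- corners together weigh at least the two leading terms. So neither leading term can outweigh
    -- its corner.
    minorant-factors : ∀ {p q λ₁ λ₂} → v (lc p) ≡ [ λ₁ ] → v (lc q) ≡ [ λ₂ ] →
      Corner p → Corner q → Minorant (ω (deg p) λ₁ ℤ.+ ω (deg q) λ₂) (p *ₚ q) →
      Minorant (ω (deg p) λ₁) p × Minorant (ω (deg q) λ₂) q
    minorant-factors {p} {q} {λ₁} {λ₂} vp vq P Q w≤ =
      (λ i α vi → ℤ.≤-trans (+-cancelʳ-≤ (ω (deg q) λ₂) (ℤ.≤-trans (minorant-* w≤ P Q)
        (ℤ.+-monoʳ-≤ (ω (index P) (value P)) (minimal Q (deg q) λ₂ vq)))) (minimal P i α vi)) ,
      (λ i α vi → ℤ.≤-trans (+-cancelˡ-≤ (ω (deg p) λ₁) (ℤ.≤-trans (minorant-* w≤ P Q)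
        (ℤ.+-monoˡ-≤ (ω (index Q) (value Q)) (minimal P (deg p) λ₁ vp)))) (minimal Q i α vi))

  -- Slopes at finite and at infinite values.

  m-finite : ∀ f i {α} .(i<n : i < deg f) → v (coeff f i) ≡ [ α ] →
    m f i i<n ≡ [ ℚ._/_ (finite⁺ (v (lc f)) ℤ.- α) (deg f ∸ i) {{∸-nonZero i<n}} ]
  m-finite f i i<n vi with v (coeff f i) | vi
  ... | [ _ ] | refl = refl

  m-⊤ : ∀ f i .(i<n : i < deg f) → v (coeff f i) ≡ ⊤⁺ → m f i i<n ≡ ⊥₋
  m-⊤ f i i<n vi with v (coeff f i) | vi
  ... | ⊤⁺ | refl = refl

open import Data.Nat.Base using (_*_)

-- Factorisations of f under (a) and (b).

theorem1 : ∀ {c ℓ k ℓk} (D : DiscreteValuationDomain c ℓ k ℓk) →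
    let module D = DiscreteValuationDomain D
        open Polynomial D
    in
    (f : R[x]) →
    let n = deg f in
    2 ≤ n →
    ¬ (coeff f 0 D.* coeff f n D.≈ D.0#) →
    (s : ℕ) (s<n : s < n) →
    (∀ i (i<n : i < n) → i ≢ s → m f i i<n <₋ m f s s<n) →
    (s ≢ 0 →
      + d f s ℚ./ 1 ≡
        (+ (n * (n ∸ s)) ℚ./ 1) ℚ.*
          (finite₋ (m f s s<n) ℚ.- finite₋ (m f 0 (m<n⇒0<n s<n)))) →
    (s ≡ 0 → d f s ≡ 1) →
    (f₁ f₂ : R[x]) → f ≈ₚ f₁ *ₚ f₂ →
    let q = _/_ (n ∸ s) (d f s) {{d-nonZero f s s<n}} in
    (q ∣ deg f₁) ⊎ (q ∣ deg f₂)
theorem1 D f _ a₀aₙ≉0 s s<n slopes gap _ f₁ f₂ f≈f₁f₂ =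
  -- `d f s` unfolds to the gcd of `∣ A ∣` and `N`; the two minorants at index 0 make both excesses
  -- non-negative.
  Weight.excess≤gcd⇒∣ A N {{d-nonZero f s s<n}} n₁ n₂ κ₁ κ₂ λ₁ λ₂
    (proj₁ minorants 0 κ₁ v-c₁)
    (proj₂ minorants 0 κ₂ v-c₂)
    (subst (ℤ._≤ + d f s) excess-f (excess≤d (s ℕ.≟ 0)))
  where
  open DiscreteValuationDomain D hiding (_*_)
  open Polynomial D
  open PolynomialProperties D
  module R = CommutativeRing R
  n  = deg f
  n₁ = deg f₁
  n₂ = deg f₂
  N  = n ∸ s
  ν  = finite⁺ (v (lc f))
  λ₁ = finite⁺ (v (lc f₁))
  λ₂ = finite⁺ (v (lc f₂))
  σ  = finite⁺ (v (coeff f s))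
  κ  = finite⁺ (v (coeff f 0))
  κ₁ = finite⁺ (v (coeff f₁ 0))
  κ₂ = finite⁺ (v (coeff f₂ 0))
  A  = σ ℤ.- ν
  open Weight A N using (ω; ω-+; excess)
  open Newton A N
  open Edge s<n σ ν

  a₀≉0 : ¬ (coeff f 0 ≈ 0#)
  a₀≉0 a₀≈0 = a₀aₙ≉0 (R.trans (R.*-congʳ a₀≈0) (R.zeroˡ _))
  aₙ≉0 : ¬ (lc f ≈ 0#)
  aₙ≉0 aₙ≈0 = a₀aₙ≉0 (R.trans (R.*-congˡ aₙ≈0) (R.zeroʳ _))
  a₀≈c₁c₂ : coeff f 0 ≈ coeff f₁ 0 R.* coeff f₂ 0
  a₀≈c₁c₂ = R.trans (f≈f₁f₂ 0) (coeff-*-0 f₁ f₂)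
  c₁≉0 : ¬ (coeff f₁ 0 ≈ 0#)
  c₁≉0 c₁≈0 = a₀≉0 (R.trans a₀≈c₁c₂ (R.trans (R.*-congʳ c₁≈0) (R.zeroˡ _)))
  c₂≉0 : ¬ (coeff f₂ 0 ≈ 0#)
  c₂≉0 c₂≈0 = a₀≉0 (R.trans a₀≈c₁c₂ (R.trans (R.*-congˡ c₂≈0) (R.zeroʳ _)))
  l₁≉0 : ¬ (lc f₁ ≈ 0#)
  l₁≉0 l₁≈0 = c₁≉0 (lc≈0⇒coeff≈0 f₁ l₁≈0 0)
  l₂≉0 : ¬ (lc f₂ ≈ 0#)
  l₂≉0 l₂≈0 = c₂≉0 (lc≈0⇒coeff≈0 f₂ l₂≈0 0)
  -- For s ≠ 0, (a) at index 0 puts m₀ strictly below mₛ, so mₛ is not -∞.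
  aₛ≉0 : ¬ (coeff f s ≈ 0#)
  aₛ≉0 aₛ≈0 = by-cases (s ℕ.≟ 0)
    where
    0<n = m<n⇒0<n s<n
    <⊥₋-absurd : ∀ {x} → ¬ (x <₋ ⊥₋)
    <⊥₋-absurd ()
    by-cases : ¬ Dec (s ≡ 0)
    by-cases (yes s≡0) = a₀≉0 (subst (λ i → coeff f i ≈ 0#) s≡0 aₛ≈0)
    by-cases (no s≢0)  = <⊥₋-absurd (subst (m f 0 0<n <₋_)
      (m-⊤ f s s<n (trans (v-cong aₛ≈0) v-0)) (slopes 0 0<n (λ 0≡s → s≢0 (sym 0≡s))))

  v-c₁ = ≉0⇒v-finite c₁≉0
  v-c₂ = ≉0⇒v-finite c₂≉0
  v-l₁ = ≉0⇒v-finite l₁≉0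
  v-l₂ = ≉0⇒v-finite l₂≉0
  v-aₛ = ≉0⇒v-finite aₛ≉0

  n≡n₁+n₂ : n ≡ n₁ ℕ.+ n₂
  n≡n₁+n₂ = deg-* f f₁ f₂ f≈f₁f₂ aₙ≉0 (v-finite⇒≉0 (v-*-finite v-l₁ v-l₂))
  ν≡λ₁+λ₂ : ν ≡ λ₁ ℤ.+ λ₂
  ν≡λ₁+λ₂ = cong finite⁺ (trans
    (v-cong (R.trans (R.reflexive (cong (coeff f) n≡n₁+n₂)) (R.trans (f≈f₁f₂ _) (coeff-*-deg f₁ f₂))))
    (v-*-finite v-l₁ v-l₂))
  κ≡κ₁+κ₂ : κ ≡ κ₁ ℤ.+ κ₂
  κ≡κ₁+κ₂ = cong finite⁺ (trans (v-cong a₀≈c₁c₂) (v-*-finite v-c₁ v-c₂))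

  -- Index s has the weight of index n by `ω-edge`; (a) bounds the other terms below n, and above n
  -- all coefficients are zero.
  minorant-f : Minorant (ω n ν) f
  minorant-f i α vi = by-cases (ℕ.<-cmp i n) (i ℕ.≟ s)
    where
    by-cases : Tri (i < n) (i ≡ n) (n < i) → Dec (i ≡ s) → ω n ν ℤ.≤ ω i α
    by-cases (tri> _ _ n<i)  _          =
      contradiction (deg<⇒coeff≈0 f n<i) (v-finite⇒≉0 vi)
    by-cases (tri≈ _ refl _) _          = ℤ.≤-reflexive (cong (λ w → ω n (finite⁺ w)) vi)
    by-cases (tri< _ _ _)    (yes refl) =
      ℤ.≤-reflexive (trans ω-edge (cong (λ w → ω s (finite⁺ w)) vi))
    by-cases (tri< i<n _ _)  (no i≢s)   =
      slope<⇒ω≤ i<n (/-cancel-< (ν ℤ.- α) (n ∸ i) (ν ℤ.- σ) N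
        {{∸-nonZero i<n}} {{∸-nonZero s<n}} ([<]-injective
          (subst₂ _<₋_ (m-finite f i i<n vi) (m-finite f s s<n v-aₛ) (slopes i i<n i≢s))))

  minorants : Minorant (ω n₁ λ₁) f₁ × Minorant (ω n₂ λ₂) f₂
  minorants = minorant-factors {f₁} {f₂} v-l₁ v-l₂ (corner f₁ l₁≉0) (corner f₂ l₂≉0) λ i α vi →
    subst (ℤ._≤ ω i α)
      (trans (cong₂ ω n≡n₁+n₂ ν≡λ₁+λ₂) (ω-+ n₁ n₂ λ₁ λ₂))
      (minorant-f i α (trans (v-cong (f≈f₁f₂ i)) vi))

  excess-f : excess n κ ν ≡ excess (n₁ ℕ.+ n₂) (κ₁ ℤ.+ κ₂) (λ₁ ℤ.+ λ₂)
  excess-f = cong₂ ℤ._-_ (cong (ω 0) κ≡κ₁+κ₂) (cong₂ ω n≡n₁+n₂ ν≡λ₁+λ₂)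

  excess≤d : Dec (s ≡ 0) → excess n κ ν ℤ.≤ + d f s
  excess≤d (yes s≡0) = subst (ℤ._≤ + d f s)
    (trans (sym (excess-edge s≡0)) (cong (λ i → excess n (finite⁺ (v (coeff f i))) ν) s≡0))
    (ℤ.+≤+ ℕ.z≤n)
  -- Cleared of denominators, (b) says that the excess of `f` equals `d f s`.
  excess≤d (no s≢0) = ℤ.≤-reflexive (sym (trans
    (clearDenominators (+ d f s) (ν ℤ.- σ) N (ν ℤ.- κ) n
      {{∸-nonZero s<n}} {{∸-nonZero (m<n⇒0<n s<n)}}
      (trans (gap s≢0) (cong₂ (λ x y → (+ (n * N) ℚ./ 1) ℚ.* (finite₋ x ℚ.- finite₋ y))
        (m-finite f s s<n v-aₛ) (m-finite f 0 (m<n⇒0<n s<n) (≉0⇒v-finite a₀≉0)))))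
    (excess-gap κ)))
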